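{- Let $m \ge 2$ and $n \ge 1$ be integers. Let $G$ be a graph with maximum degree $\Delta \ge 1$ whose vertex set admits a partition $V(G) = U_1 \cup U_2 \cup \dots \cup U_m$ into independent sets with $|U_i| \le n$ for all $i \in [m]$. Let $c$ be a locally $\left(\frac{n}{48\Delta^2}\right)$-bounded coloring of the complete balanced $m$-partite graph $K_{m\otimes n}$. Then $c$ is $G$-proper, i.e. the colored graph $K_{m\otimes n}$ contains a properly colored copy of $G$.
   Context: $K_{m\otimes n}$ denotes the complete $m$-partite graph with exactly $n$ vertices in each of its $m$ classes. A coloring of a graph $H$ is an arbitrary edge-coloring $c: E(H)\to\mathbb{N}$ (not necessarily proper). For a real number $k$, a coloring $c$ is locally $k$-bounded if each vertex of $H$ is incident to at most $k$ edges of any given color. A copy of $G$ in $H$ is a subgraph of $H$ isomorphic to $G$; it is properly colored if any two distinct edges of it sharing a vertex receive distinct colors. A coloring $c$ of $H$ is $G$-proper if $H$ contains a properly colored copy of $G$. -}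

module Defs where

open import Data.Nat.Base using (ℕ; NonZero; _*_; _^_)
open import Data.Nat.Properties using (_≟_; m*n≢0; m^n≢0)
open import Data.Integer.Base using (+_)
open import Data.Rational.Base using (ℚ; _/_; _≤_)
open import Data.Fin.Base using (Fin; quotient)
import Data.Fin.Properties as Fin
open import Data.Fin.Subset using (Subset; _∈_)
open import Data.List.Base using (length; filter; map; allFin)
open import Data.List.Extrema.Nat using (max)
open import Data.Product.Base using (Σ; ∃; _×_; _,_; proj₁; proj₂)
open import Data.Product using (∃!)
open import Function.Bundles using (_⤖_; _⇔_; Bijection)
open import Relation.Binary.Definitions using (Decidable; Irreflexive; Symmetric)
open import Relation.Binary.PropositionalEquality using (_≡_; _≢_; refl; sym)
open import Relation.Nullary using (¬_; yes; no; ¬?)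

-- Simple graphs.  Decidability of adjacency is what makes degrees computable;
-- it is no restriction on finite graphs in the classical sense.
record Graph (V : Set) : Set₁ where
  infix 4 _~_ _~?_
  field
    _~_      : V → V → Set
    _~?_     : Decidable _~_
    ~-sym    : Symmetric _~_
    ~-irrefl : Irreflexive _≡_ _~_

record _≅_ {V W : Set} (G : Graph V) (H : Graph W) : Set where
  private
    module G = Graph G
    module H = Graph H
  field
    bijection : V ⤖ W
  open Bijection bijection using (to)
  field
    adjacency : ∀ u v → (u G.~ v) ⇔ (to u H.~ to v)

-- Finite graphs are taken on the vertex sets Fin k.

degree : ∀ {k} → Graph (Fin k) → Fin k → ℕ
degree {k} G v = length (filter (v ~?_) (allFin k))
  where open Graph G

-- The base value 0 only matters for the graph without vertices.
maxDegree : ∀ {k} → Graph (Fin k) → ℕ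
maxDegree {k} G = max 0 (map (degree G) (allFin k))

Independent : ∀ {k} → Graph (Fin k) → Subset k → Set
Independent G S = ∀ u v → u ∈ S → v ∈ S → ¬ (u ~ v)
  where open Graph G

-- Parts may be empty.
IsPartition : ∀ {k m} → (Fin m → Subset k) → Set
IsPartition U = ∀ v → ∃! _≡_ (λ i → v ∈ U i)

-- K m n is the complete m-partite graph with classes of size n: identifying
-- Fin (m * n) with Fin m × Fin n, `quotient n` gives the class of a vertex.
K : ∀ m n → Graph (Fin (m * n))
K m n = record
  { _~_      = λ u v → quotient {m} n u ≢ quotient {m} n v
  ; _~?_     = λ u v → ¬? (quotient {m} n u Fin.≟ quotient {m} n v)
  ; ~-sym    = λ u≢v v≡u → u≢v (sym v≡u)
  ; ~-irrefl = λ { refl u≢u → u≢u refl }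
  }

-- A function on unordered edges: the colour is independent of the proof of
-- adjacency (by irrelevance) and of the order of the endpoints.
record Coloring {V : Set} (H : Graph V) : Set where
  open Graph H
  field
    colour     : ∀ u v → .(u ~ v) → ℕ
    colour-sym : ∀ u v .(e : u ~ v) → colour u v e ≡ colour v u (~-sym e)

module _ {k : ℕ} {H : Graph (Fin k)} (c : Coloring H) where
  open Graph H
  open Coloring c

  EdgeOfColour : ℕ → Fin k → Fin k → Set
  EdgeOfColour a u v = Σ (u ~ v) (λ e → colour u v e ≡ a)

  edgeOfColour? : ∀ a → Decidable (EdgeOfColour a)
  edgeOfColour? a u v with u ~? v
  ... | no ¬e = no (λ p → ¬e (proj₁ p))
  ... | yes e with colour u v e ≟ a
  ...   | yes q = yes (e , q)
  ...   | no ¬q = no (λ p → ¬q (proj₂ p))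

  -- The edges at v are counted through their other endpoints.
  colourDegree : ℕ → Fin k → ℕ
  colourDegree a v = length (filter (edgeOfColour? a v) (allFin k))

  LocallyBounded : ℚ → Set
  LocallyBounded q = ∀ v a → + colourDegree a v / 1 ≤ q

record Subgraph {k : ℕ} (H : Graph (Fin k)) : Set₁ where
  open Graph H
  field
    vertices : Subset k
    _~ₛ_ : Fin k → Fin k → Set
    _~ₛ?_ : Decidable _~ₛ_
    ~ₛ-sym : Symmetric _~ₛ_
    ~ₛ⇒~ : ∀ {u v} → u ~ₛ v → u ~ v
    ~ₛ⇒∈ : ∀ {u v} → u ~ₛ v → u ∈ vertices × v ∈ vertices

  toGraph : Graph (∃ (λ v → v ∈ vertices))
  toGraph = record
    { _~_      = λ u v → proj₁ u ~ₛ proj₁ v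
    ; _~?_     = λ u v → proj₁ u ~ₛ? proj₁ v
    ; ~-sym    = ~ₛ-sym
    ; ~-irrefl = λ { refl e → ~-irrefl refl (~ₛ⇒~ e) }
    }

-- Distinct edges sharing the vertex u have distinct other endpoints v and w.
ProperlyColored : ∀ {k} {H : Graph (Fin k)} → Coloring H → Subgraph H → Set
ProperlyColored c S =
  ∀ u v w (e : u ~ₛ v) (f : u ~ₛ w) → v ≢ w →
    colour u v (~ₛ⇒~ e) ≢ colour u w (~ₛ⇒~ f)
  where
  open Subgraph S
  open Coloring c

IsProper : ∀ {k l} {H : Graph (Fin k)} → Graph (Fin l) → Coloring H → Set₁
IsProper {H = H} G c =
  Σ (Subgraph H) (λ S → G ≅ Subgraph.toGraph S × ProperlyColored c S)

instance
  48Δ²≢0 : ∀ {Δ} .{{_ : NonZero Δ}} → NonZero (48 * Δ ^ 2)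
  48Δ²≢0 {Δ} = m*n≢0 48 (Δ ^ 2) {{_}} {{m^n≢0 Δ 2}}

{-# OPTIONS --safe #-}

-- A class-preserving injection is an injective choice of positions inside each class.
-- Choose one uniformly at random.  For every cherry of G (a vertex v with two neighbours u < w)
-- and every placement of it on three points of K m n whose two edges have the same colour, the
-- bad event says that this placement occurs.  Exchanging two positions inside a class shows that
-- a given placement has probability at most 1/(n²(n-1)), even after conditioning on avoiding any
-- set of placements that share neither a vertex nor a point with it.  At most 9Δ²n²b placements
-- share a vertex or a point with a given one, where b = ⌊n/(48Δ²)⌋, and 4 · 9Δ²n²b ≤ n²(n-1).
-- Hence the symmetric Lovász local lemma, in its lopsided form, provides an injection
-- that avoids all bad events.
module Submission where

open import Defs
open import Data.Bool.Base using (if_then_else_; true; false)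
open import Data.Empty using (⊥)
open import Data.Fin.Base as Fin using (Fin; zero; suc; combine; quotient; fromℕ<; punchIn)
open import Data.Fin.Permutation.Components using (transpose; transpose-inverse)
open import Data.Fin.Properties as Fin
  using (_≟_; _<?_; any?; all?; combine-injective; combine-injectiveʳ; remQuot-combine;
         fromℕ<-injective; punchIn-injective; punchInᵢ≢i)
open import Data.Fin.Subset using (Subset; ∣_∣; inside; outside) renaming (_∈_ to _∈ˢ_)
open import Data.Fin.Subset.Properties using (_∈?_; drop-there)
import Data.Integer.Base as ℤ
import Data.Integer.Properties as ℤ
open import Data.List.Base
  using (List; []; _∷_; _++_; map; length; filter; cartesianProduct; cartesianProductWith; allFin)
open import Data.List.Extrema.Nat using (xs≤max)
open import Data.List.Membership.Propositional using (_∈_; lose)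
open import Data.List.Membership.Propositional.Properties
  using (∈-∃++; ∈-allFin; ∈-filter⁺; ∈-filter⁻; ∈-map⁺; ∈-cartesianProduct⁺; ∈-cartesianProductWith⁺)
open import Data.List.Properties using (filter-notAll; length-tabulate; map-tabulate)
open import Data.List.Relation.Binary.Subset.Propositional using (_⊆_)
open import Data.List.Relation.Unary.All as All using (All; []; _∷_)
import Data.List.Relation.Unary.All.Properties as All
open import Data.List.Relation.Unary.AllPairs using ([]; _∷_)
open import Data.List.Relation.Unary.Any as Any using (Any; here; there)
open import Data.List.Relation.Unary.Unique.Propositional using (Unique)
open import Data.List.Relation.Unary.Unique.Propositional.Properties using (map⁺; allFin⁺)
open import Data.Nat.Base hiding (_/_)
import Data.Nat.DivMod as DivMod
open import Data.Nat.ListAction using (sum)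
open import Data.Nat.Properties hiding (_≟_; _<?_)
open import Data.Nat.Tactic.RingSolver using (solve-∀)
open import Data.Product.Base using (Σ; _×_; _,_; proj₁; proj₂; ∃; ∃₂)
open import Data.Rational.Base as ℚ using (_/_)
import Data.Rational.Properties as ℚ
import Data.Rational.Unnormalised.Base as ℚᵘ
import Data.Rational.Unnormalised.Properties as ℚᵘ
open import Data.Sum.Base using (_⊎_; inj₁; inj₂)
open import Data.Vec.Base as Vec using (Vec; []; _∷_; lookup)
open import Data.Vec.Properties using (lookup∘tabulate; lookup⇒[]=; []=⇒lookup)
open import Data.Vec.Properties.WithK using ([]=-irrelevant)
open import Function.Base using (_∘_; id)
open import Function.Bundles using (mk⤖; mk⇔)
open import Relation.Binary.Definitions using (Decidable; Tri; tri<; tri≈; tri>)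
open import Relation.Binary.PropositionalEquality
open import Relation.Nullary
  using (Dec; yes; no; does; ¬_; ¬?; contradiction; _×-dec_; _⊎-dec_; _→-dec_)
open import Relation.Nullary.Decidable using (dec-true)
open import Relation.Unary using () renaming (Decidable to Decidable₁)

private variable
  A B C P Q R : Set

-- Indicators of decidable propositions.

𝟙 : Dec P → ℕ
𝟙 d = if does d then 1 else 0

𝟙-mono : (P → Q) → (d : Dec P) (e : Dec Q) → 𝟙 d ≤ 𝟙 e
𝟙-mono f (no _)  e       = z≤n
𝟙-mono f (yes p) (yes q) = ≤-refl
𝟙-mono f (yes p) (no ¬q) = contradiction (f p) ¬q

𝟙-yes : (d : Dec P) → P → 1 ≤ 𝟙 d
𝟙-yes (yes _) _ = ≤-refl
𝟙-yes (no ¬p) p = contradiction p ¬p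

𝟙≤1 : (d : Dec P) → 𝟙 d ≤ 1
𝟙≤1 (yes _) = ≤-refl
𝟙≤1 (no _)  = z≤n

𝟙-positive : (d : Dec P) → 1 ≤ 𝟙 d → P
𝟙-positive (yes p) _ = p

𝟙-cover : (P → Q ⊎ R) → (d : Dec P) (e : Dec Q) (e′ : Dec R) → 𝟙 d ≤ 𝟙 e + 𝟙 e′
𝟙-cover f (no _)  e e′ = z≤n
𝟙-cover f (yes p) e e′ with f p
... | inj₁ q = ≤-trans (𝟙-yes e q) (m≤m+n _ _)
... | inj₂ r = ≤-trans (𝟙-yes e′ r) (m≤n+m _ _)

𝟙-exclusive : (P → ¬ Q) → (d : Dec P) (e : Dec Q) → 𝟙 d + 𝟙 e ≤ 1
𝟙-exclusive h (no _)  e       = 𝟙≤1 e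
𝟙-exclusive h (yes p) (no _)  = ≤-refl
𝟙-exclusive h (yes p) (yes q) = contradiction q (h p)

𝟙-× : (d : Dec P) (e : Dec Q) → 𝟙 (d ×-dec e) ≡ 𝟙 d * 𝟙 e
𝟙-× (yes _) e = sym (+-identityʳ (𝟙 e))
𝟙-× (no _)  e = refl

-- Finite sums over lists.

∑ : List A → (A → ℕ) → ℕ
∑ xs f = sum (map f xs)

syntax ∑ xs (λ x → e) = ∑[ x ← xs ] e
infix 5 ∑

∑-mono : ∀ (xs : List A) {f g} → (∀ x → f x ≤ g x) → ∑ xs f ≤ ∑ xs g
∑-mono []       h = z≤n
∑-mono (x ∷ xs) h = +-mono-≤ (h x) (∑-mono xs h)

∑-cong : ∀ (xs : List A) {f g} → (∀ x → f x ≡ g x) → ∑ xs f ≡ ∑ xs g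
∑-cong []       h = refl
∑-cong (x ∷ xs) h = cong₂ _+_ (h x) (∑-cong xs h)

∑-≤-length : ∀ {c} {xs : List A} {f} → All (λ x → f x ≤ c) xs → ∑ xs f ≤ length xs * c
∑-≤-length []       = z≤n
∑-≤-length (h ∷ hs) = +-mono-≤ h (∑-≤-length hs)

∑-const : ∀ (xs : List A) c → (∑[ x ← xs ] c) ≡ length xs * c
∑-const []       c = refl
∑-const (x ∷ xs) c = cong (c +_) (∑-const xs c)

∑-+ : ∀ (xs : List A) {f g} → (∑[ x ← xs ] (f x + g x)) ≡ ∑ xs f + ∑ xs g
∑-+ []       = refl
∑-+ (x ∷ xs) {f} {g} = trans (cong (f x + g x +_) (∑-+ xs)) (lemma (f x) (g x) (∑ xs f) (∑ xs g))
  where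
  lemma : ∀ a b c d → a + b + (c + d) ≡ a + c + (b + d)
  lemma = solve-∀

∑-*ˡ : ∀ c (xs : List A) {f} → (∑[ x ← xs ] (c * f x)) ≡ c * ∑ xs f
∑-*ˡ c []           = sym (*-zeroʳ c)
∑-*ˡ c (x ∷ xs) {f} = trans (cong (c * f x +_) (∑-*ˡ c xs)) (sym (*-distribˡ-+ c (f x) _))

∑-*ʳ : ∀ c (xs : List A) {f} → (∑[ x ← xs ] (f x * c)) ≡ ∑ xs f * c
∑-*ʳ c xs {f} = trans (∑-cong xs (λ x → *-comm (f x) c)) (trans (∑-*ˡ c xs) (*-comm c _))

∑-swap : ∀ (xs : List A) (ys : List B) {f : A → B → ℕ} →
         (∑[ x ← xs ] ∑[ y ← ys ] f x y) ≡ (∑[ y ← ys ] ∑[ x ← xs ] f x y)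
∑-swap []       ys = sym (trans (∑-const ys 0) (*-zeroʳ (length ys)))
∑-swap (x ∷ xs) ys = trans (cong (_ +_) (∑-swap xs ys)) (sym (∑-+ ys))

∑-++ : ∀ (xs ys : List A) {f} → ∑ (xs ++ ys) f ≡ ∑ xs f + ∑ ys f
∑-++ []       ys     = refl
∑-++ (x ∷ xs) ys {f} = trans (cong (f x +_) (∑-++ xs ys)) (sym (+-assoc (f x) _ _))

∑-map : ∀ (g : A → B) xs {f} → ∑ (map g xs) f ≡ ∑ xs (f ∘ g)
∑-map g []           = refl
∑-map g (x ∷ xs) {f} = cong (f (g x) +_) (∑-map g xs)

∑-cartesianProductWith : ∀ (g : A → B → C) xs ys {f} →
  ∑ (cartesianProductWith g xs ys) f ≡ (∑[ x ← xs ] ∑[ y ← ys ] f (g x y))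
∑-cartesianProductWith g []       ys = refl
∑-cartesianProductWith g (x ∷ xs) ys = trans (∑-++ (map (g x) ys) _)
  (cong₂ _+_ (∑-map (g x) ys) (∑-cartesianProductWith g xs ys))

∑-filter : ∀ {P : A → Set} (P? : Decidable₁ P) xs {f} →
           ∑ (filter P? xs) f ≡ (∑[ x ← xs ] (𝟙 (P? x) * f x))
∑-filter P? []           = refl
∑-filter P? (x ∷ xs) {f} with does (P? x)
... | true  = cong₂ _+_ (sym (+-identityʳ (f x))) (∑-filter P? xs)
... | false = ∑-filter P? xs

∑-filter-≤ : ∀ {P : A → Set} (P? : Decidable₁ P) xs {f} → ∑ (filter P? xs) f ≤ ∑ xs f
∑-filter-≤ P? xs {f} = ≤-trans (≤-reflexive (∑-filter P? xs))
  (∑-mono xs (λ x → ≤-trans (*-monoˡ-≤ (f x) (𝟙≤1 (P? x))) (≤-reflexive (*-identityˡ (f x)))))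

length-filter≡∑ : ∀ {P : A → Set} (P? : Decidable₁ P) xs → length (filter P? xs) ≡ ∑ xs (𝟙 ∘ P?)
length-filter≡∑ P? []       = refl
length-filter≡∑ P? (x ∷ xs) with does (P? x)
... | true  = cong suc (length-filter≡∑ P? xs)
... | false = length-filter≡∑ P? xs

∈⇒≤∑ : ∀ {x : A} {xs} f → x ∈ xs → f x ≤ ∑ xs f
∈⇒≤∑ f (here refl) = m≤m+n _ _
∈⇒≤∑ f (there x∈)  = ≤-trans (∈⇒≤∑ f x∈) (m≤n+m _ _)

∑-positive : ∀ (xs : List A) f → 1 ≤ ∑ xs f → ∃ λ x → 1 ≤ f x
∑-positive (x ∷ xs) f h with f x in eq
... | zero  = ∑-positive xs f h
... | suc _ = x , subst (1 ≤_) (sym eq) (s≤s z≤n)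

-- The head of `xs` is cut out of `ys`; uniqueness keeps the tail of `xs` inside what remains.
∑-Unique-⊆ : ∀ {xs ys : List A} f → Unique xs → xs ⊆ ys → ∑ xs f ≤ ∑ ys f
∑-Unique-⊆ {xs = []}     f _              _   = z≤n
∑-Unique-⊆ {xs = x ∷ xs} f (x∉xs ∷ uniq) sub with ∈-∃++ (sub (here refl))
... | as , bs , refl = begin
  f x + ∑ xs f                     ≤⟨ +-monoʳ-≤ (f x) (∑-Unique-⊆ f uniq sub′) ⟩
  f x + ∑ (as ++ bs) f             ≡⟨ cong (f x +_) (∑-++ as bs) ⟩
  f x + (∑ as f + ∑ bs f)          ≡⟨ lemma (f x) (∑ as f) (∑ bs f) ⟩
  ∑ as f + (f x + ∑ bs f)          ≡⟨ ∑-++ as (x ∷ bs) ⟨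
  ∑ (as ++ x ∷ bs) f               ∎
  where
  open ≤-Reasoning
  lemma : ∀ a b c → a + (b + c) ≡ b + (a + c)
  lemma = solve-∀
  remove : ∀ {z} as → z ∈ as ++ x ∷ bs → z ≢ x → z ∈ as ++ bs
  remove []       (here z≡x) z≢x = contradiction z≡x z≢x
  remove []       (there z∈) z≢x = z∈
  remove (a ∷ as) (here z≡a) z≢x = here z≡a
  remove (a ∷ as) (there z∈) z≢x = there (remove as z∈ z≢x)
  sub′ : xs ⊆ as ++ bs
  sub′ z∈ = remove as (sub (there z∈)) (λ { refl → All.lookup x∉xs z∈ refl })

∑-injection : ∀ {k l} (g : Fin k → Fin l) → (∀ {i j} → g i ≡ g j → i ≡ j) →
              ∀ f → ∑ (allFin k) (f ∘ g) ≤ ∑ (allFin l) f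
∑-injection {k} g inj f = ≤-trans (≤-reflexive (sym (∑-map g (allFin k))))
  (∑-Unique-⊆ f (map⁺ inj (allFin⁺ k)) (λ _ → ∈-allFin _))

∑-Unique-≤1 : ∀ {xs : List A} {P : A → Set} (P? : Decidable₁ P) → Unique xs →
              (∀ {x y} → P x → P y → x ≡ y) → ∑ xs (𝟙 ∘ P?) ≤ 1
∑-Unique-≤1 {xs = []}     P? _              _   = z≤n
∑-Unique-≤1 {xs = x ∷ xs} P? (x∉xs ∷ uniq) one with P? x
... | no _  = ∑-Unique-≤1 P? uniq one
... | yes p = s≤s (≤-trans (∑-≤-length (All.map zero′ x∉xs)) (≤-reflexive (*-zeroʳ (length xs))))
  where
  zero′ : ∀ {y} → x ≢ y → 𝟙 (P? y) ≤ 0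
  zero′ {y} x≢y with P? y
  ... | yes q = contradiction (one p q) x≢y
  ... | no _  = z≤n

length-allFin : ∀ n → length (allFin n) ≡ n
length-allFin n = length-tabulate {n = n} (λ i → i)

𝟙-any≤∑ : ∀ {P : A → Set} (P? : Decidable₁ P) xs → 𝟙 (Any.any? P? xs) ≤ ∑ xs (𝟙 ∘ P?)
𝟙-any≤∑ P? []       = z≤n
𝟙-any≤∑ P? (x ∷ xs) with P? x
... | yes _ = s≤s z≤n
... | no _  = 𝟙-any≤∑ P? xs

-- Enumeration of vectors.

allVecs : ∀ n k → List (Vec (Fin n) k)
allVecs n zero    = [] ∷ []
allVecs n (suc k) = cartesianProductWith _∷_ (allFin n) (allVecs n k)

∈-allVecs : ∀ {n k} (v : Vec (Fin n) k) → v ∈ allVecs n k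
∈-allVecs []      = here refl
∈-allVecs (i ∷ v) = ∈-cartesianProductWith⁺ _∷_ (∈-allFin i) (∈-allVecs v)

-- Induction on the length, with `∑-injection` for the first coordinate. This replaces measure
-- preservation: an injection applied in every coordinate reindexes the vectors without repeating
-- any.
∑-allVecs-injection : ∀ {n k} (g : Fin k → Fin n → Fin n) → (∀ u {i j} → g u i ≡ g u j → i ≡ j) →
  ∀ φ → (∑[ v ← allVecs n k ] φ (Vec.tabulate (λ u → g u (lookup v u)))) ≤ ∑ (allVecs n k) φ
∑-allVecs-injection {n} {zero}  g inj φ = ≤-refl
∑-allVecs-injection {n} {suc k} g inj φ = begin
  ∑ (allVecs n (suc k)) (λ v → φ (Vec.tabulate (λ u → g u (lookup v u))))
    ≡⟨ ∑-cartesianProductWith _∷_ (allFin n) (allVecs n k) ⟩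
  (∑[ i ← allFin n ] ∑[ v ← allVecs n k ] φ (g zero i ∷ Vec.tabulate (λ u → g (suc u) (lookup v u))))
    ≤⟨ ∑-mono (allFin n) (λ i → ∑-allVecs-injection (g ∘ suc) (λ u → inj (suc u)) (λ v → φ (g zero i ∷ v))) ⟩
  (∑[ i ← allFin n ] ∑[ v ← allVecs n k ] φ (g zero i ∷ v))
    ≤⟨ ∑-injection (g zero) (inj zero) (λ i → ∑[ v ← allVecs n k ] φ (i ∷ v)) ⟩
  (∑[ i ← allFin n ] ∑[ v ← allVecs n k ] φ (i ∷ v))
    ≡⟨ ∑-cartesianProductWith _∷_ (allFin n) (allVecs n k) ⟨
  ∑ (allVecs n (suc k)) φ ∎
  where open ≤-Reasoning

-- The lopsided local lemma, by counting outcomes.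

module LocalLemma {F E : Set} (Ω : List F)
  {Valid : F → Set} (valid? : Decidable₁ Valid)
  {Occurs : E → F → Set} (occurs? : Decidable Occurs)
  {Neighbour : E → E → Set} (neighbour? : Decidable Neighbour) where

  -- Validity is built into avoidance, so `#avoiding []` measures the whole sample space, and
  -- `#hitting A S` over `#avoiding S` is the conditional probability of `A` given that `S` is
  -- avoided.
  Avoids : List E → F → Set
  Avoids S f = Valid f × All (λ A → ¬ Occurs A f) S

  avoids? : ∀ S → Decidable₁ (Avoids S)
  avoids? S f = valid? f ×-dec All.all? (λ A → ¬? (occurs? A f)) S

  #avoiding : List E → ℕ
  #avoiding S = ∑[ f ← Ω ] 𝟙 (avoids? S f)

  #hitting : E → List E → ℕ
  #hitting A S = ∑[ f ← Ω ] 𝟙 (occurs? A f ×-dec avoids? S f)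

  neighbours strangers : E → List E → List E
  neighbours A = filter (neighbour? A)
  strangers  A = filter (¬? ∘ neighbour? A)

  #avoiding-∷ : ∀ A S → #avoiding S ≤ #avoiding (A ∷ S) + #hitting A S
  #avoiding-∷ A S = ≤-trans
    (∑-mono Ω (λ f → 𝟙-cover split (avoids? S f) (avoids? (A ∷ S) f) (occurs? A f ×-dec avoids? S f)))
    (≤-reflexive (∑-+ Ω))
    where
    split : ∀ {f} → Avoids S f → Avoids (A ∷ S) f ⊎ Occurs A f × Avoids S f
    split {f} (v , av) with occurs? A f
    ... | yes o = inj₂ (o , v , av)
    ... | no ¬o = inj₁ (v , ¬o ∷ av)

  #hitting-strangers : ∀ A S → #hitting A S ≤ #hitting A (strangers A S)
  #hitting-strangers A S = ∑-mono Ω (λ f → 𝟙-mono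
    (λ (o , v , av) → o , v , All.filter⁺ _ av)
    (occurs? A f ×-dec avoids? S f) (occurs? A f ×-dec avoids? (strangers A S) f))

  -- Union bound: a valid outcome that avoids the strangers but not all of `S` hits some neighbour
  -- in `S`.
  #avoiding-strangers : ∀ A S → #avoiding (strangers A S) ≤
    #avoiding S + (∑[ B ← neighbours A S ] #hitting B (strangers A S))
  #avoiding-strangers A S = begin
    #avoiding T
      ≤⟨ ∑-mono Ω pointwise ⟩
    (∑[ f ← Ω ] (𝟙 (avoids? S f) + (∑[ B ← neighbours A S ] 𝟙 (occurs? B f ×-dec avoids? T f))))
      ≡⟨ ∑-+ Ω ⟩
    #avoiding S + (∑[ f ← Ω ] ∑[ B ← neighbours A S ] 𝟙 (occurs? B f ×-dec avoids? T f))
      ≡⟨ cong (#avoiding S +_) (∑-swap Ω (neighbours A S)) ⟩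
    #avoiding S + (∑[ B ← neighbours A S ] #hitting B T) ∎
    where
    open ≤-Reasoning
    T = strangers A S
    pointwise : ∀ f → 𝟙 (avoids? T f) ≤
      𝟙 (avoids? S f) + (∑[ B ← neighbours A S ] 𝟙 (occurs? B f ×-dec avoids? T f))
    pointwise f = ≤-trans (𝟙-cover split (avoids? T f) (avoids? S f) (Any.any? hit? (neighbours A S)))
                          (+-monoʳ-≤ _ (𝟙-any≤∑ hit? (neighbours A S)))
      where
      hit? : ∀ B → Dec (Occurs B f × Avoids T f)
      hit? B = occurs? B f ×-dec avoids? T f
      split : Avoids T f → Avoids S f ⊎ Any (λ B → Occurs B f × Avoids T f) (neighbours A S)
      split (v , av) with Any.any? hit? (neighbours A S)
      ... | yes hit = inj₂ hit
      ... | no ¬hit = inj₁ (v , All.filter⁻ (neighbour? A)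
              (All.map (λ ¬h o → ¬h (o , v , av)) (All.¬Any⇒All¬ _ ¬hit)) av)

  -- `D` stands for 1/p. Given the avoidance of non-neighbours, the conditional probability of `A`
  -- is only bounded above by 1/`D`; this one-sided condition is the lopsided form of independence.
  module _ {OK : E → Set} (D : ℕ) (2<D : 2 < D)
    (independent : ∀ {A} → OK A → ∀ S → All (λ B → ¬ Neighbour A B) S →
                   D * #hitting A S ≤ #avoiding S) where

    -- The condition 4pd ≤ 1, with d the number of neighbours in `S`.
    Sparse : List E → Set
    Sparse S = ∀ {A} → OK A → 4 * (∑[ B ← S ] 𝟙 (neighbour? A B)) ≤ D

    sparse-strangers : ∀ A S → Sparse S → Sparse (strangers A S)
    sparse-strangers A S sp ok = ≤-trans (*-monoʳ-≤ 4 (∑-filter-≤ (¬? ∘ neighbour? A) S)) (sp ok)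

    private
      D≢0 : NonZero D
      D≢0 = >-nonZero (<-trans z<s 2<D)

    -- The usual induction giving conditional probability at most 2p. With `T` the strangers in `S`,
    -- `independent` bounds the hits of `A` among outcomes avoiding `T`. By induction each neighbour
    -- is hit by at most a fraction 2/`D` of these, and there are at most `D`/4 neighbours, so at
    -- least half of them avoid all of `S`.
    #hitting-≤ : ∀ ℓ S → length S < ℓ → All OK S → Sparse S → ∀ {A} → OK A →
                 D * #hitting A S ≤ 2 * #avoiding S
    #hitting-≤ (suc ℓ) S (s≤s len) oks sp {A} ok = begin
      D * #hitting A S  ≤⟨ *-monoʳ-≤ D (#hitting-strangers A S) ⟩
      D * #hitting A T  ≤⟨ independent ok T (All.all-filter (¬? ∘ neighbour? A) S) ⟩
      -- The doubled inequality avoids halving in ℕ; one copy of `D * #avoiding T` then cancels.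
      #avoiding T       ≤⟨ *-cancelˡ-≤ D {{D≢0}} (+-cancelʳ-≤ (D * #avoiding T) _ _ doubled) ⟩
      2 * #avoiding S   ∎
      where
      open ≤-Reasoning
      T = strangers A S

      hit-neighbours : D * (∑[ B ← neighbours A S ] #hitting B T) ≤
                       length (neighbours A S) * (2 * #avoiding T)
      hit-neighbours = ≤-trans (≤-reflexive (sym (∑-*ˡ D (neighbours A S)))) (∑-≤-length
        (All.tabulate λ B∈ → let B∈S , AB = ∈-filter⁻ (neighbour? A) B∈ in
          #hitting-≤ ℓ T
            -- The neighbour `B` lies in `S` but not in `T`, so `T` is strictly shorter and the
            -- induction applies.
            (<-≤-trans (filter-notAll (¬? ∘ neighbour? A) S (lose B∈S (λ ¬AB → ¬AB AB))) len)
            (All.filter⁺ _ oks) (sparse-strangers A S sp) (All.lookup oks B∈S)))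

      doubled : D * #avoiding T + D * #avoiding T ≤ D * (2 * #avoiding S) + D * #avoiding T
      doubled = begin
        D * #avoiding T + D * #avoiding T
          ≡⟨ double (D * #avoiding T) ⟩
        2 * (D * #avoiding T)
          ≤⟨ *-monoʳ-≤ 2 (*-monoʳ-≤ D (#avoiding-strangers A S)) ⟩
        2 * (D * (#avoiding S + (∑[ B ← neighbours A S ] #hitting B T)))
          ≡⟨ cong (2 *_) (*-distribˡ-+ D (#avoiding S) _) ⟩
        2 * (D * #avoiding S + D * (∑[ B ← neighbours A S ] #hitting B T))
          ≤⟨ *-monoʳ-≤ 2 (+-monoʳ-≤ (D * #avoiding S) hit-neighbours) ⟩
        2 * (D * #avoiding S + length (neighbours A S) * (2 * #avoiding T))
          ≡⟨ regroup D (#avoiding S) (length (neighbours A S)) (#avoiding T) ⟩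
        D * (2 * #avoiding S) + 4 * length (neighbours A S) * #avoiding T
          ≡⟨ cong (λ z → D * (2 * #avoiding S) + 4 * z * #avoiding T) (length-filter≡∑ (neighbour? A) S) ⟩
        D * (2 * #avoiding S) + 4 * (∑[ B ← S ] 𝟙 (neighbour? A B)) * #avoiding T
          ≤⟨ +-monoʳ-≤ (D * (2 * #avoiding S)) (*-monoˡ-≤ (#avoiding T) (sp ok)) ⟩
        D * (2 * #avoiding S) + D * #avoiding T ∎
        where
        double : ∀ x → x + x ≡ 2 * x
        double = solve-∀
        regroup : ∀ d s l t → 2 * (d * s + l * (2 * t)) ≡ d * (2 * s) + 4 * l * t
        regroup = solve-∀

    -- The symmetric lopsided local lemma with p = 1/D, cleared of denominators.
    #avoiding-positive : ∀ S → 1 ≤ #avoiding [] → All OK S → Sparse S → 1 ≤ #avoiding S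
    #avoiding-positive []      h _          _  = h
    #avoiding-positive (A ∷ S) h (ok ∷ oks) sp with #avoiding (A ∷ S) in eq
    ... | suc _ = s≤s z≤n
    -- If nothing avoids `A ∷ S`, all outcomes avoiding `S` hit `A`, while at most a fraction 2/`D`
    -- of them can; as there are such outcomes, `D` would be at most 2.
    ... | zero  = contradiction D≤2 (<⇒≱ 2<D)
      where
      open ≤-Reasoning
      spS : Sparse S
      spS {B} ok = ≤-trans (*-monoʳ-≤ 4 (m≤n+m (∑[ C ← S ] 𝟙 (neighbour? B C)) (𝟙 (neighbour? B A)))) (sp ok)
      positive : NonZero (#avoiding S)
      positive = >-nonZero (#avoiding-positive S h oks spS)
      D≤2 : D ≤ 2
      D≤2 = *-cancelʳ-≤ D 2 (#avoiding S) {{positive}} (begin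
        D * #avoiding S                           ≤⟨ *-monoʳ-≤ D (#avoiding-∷ A S) ⟩
        D * (#avoiding (A ∷ S) + #hitting A S)    ≡⟨ cong (λ z → D * (z + #hitting A S)) eq ⟩
        D * #hitting A S                          ≤⟨ #hitting-≤ (suc (length S)) S ≤-refl oks spS ok ⟩
        2 * #avoiding S                           ∎)

-- Transpositions of positions.

module _ {n : ℕ} where

  transpose-left : ∀ (i j : Fin n) → transpose i j i ≡ j
  transpose-left i j with i ≟ i
  ... | yes _  = refl
  ... | no i≢i = contradiction refl i≢i

  transpose-fixed : ∀ {i j x : Fin n} → x ≢ i → x ≢ j → transpose i j x ≡ x
  transpose-fixed {i} {j} {x} x≢i x≢j with x ≟ i
  ... | yes x≡i = contradiction x≡i x≢i
  ... | no _ with x ≟ j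
  ...   | yes x≡j = contradiction x≡j x≢j
  ...   | no _    = refl

  transpose-injective : ∀ (i j : Fin n) {x y} → transpose i j x ≡ transpose i j y → x ≡ y
  transpose-injective i j eq =
    trans (sym (transpose-inverse j i)) (trans (cong (transpose j i) eq) (transpose-inverse j i))

  -- The hypothesis excludes the case where `x` is `j` and is sent to `i`.
  transpose-preimage : ∀ {i j x y : Fin n} → y ≢ i → transpose i j x ≡ y → x ≡ y ⊎ x ≡ i
  transpose-preimage {i} {j} {x} y≢i eq with x ≟ i
  ... | yes x≡i = inj₂ x≡i
  ... | no _ with x ≟ j
  ...   | yes _ = contradiction (sym eq) y≢i
  ...   | no _  = inj₁ eq

-- Random placements and exchanges inside a class.

module Placements {m n₀ k : ℕ} (part : Fin k → Fin m) where

  n : ℕ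
  n = suc n₀

  -- f sends the vertex u to the element lookup f u of the class part u.
  Assignment : Set
  Assignment = Vec (Fin n) k

  Placement : Set
  Placement = Fin k × Fin n

  -- A centre and two end points.
  Event : Set
  Event = Placement × Placement × Placement

  Ω : List Assignment
  Ω = allVecs n k

  Valid : Assignment → Set
  Valid f = ∀ u v → part u ≡ part v → lookup f u ≡ lookup f v → u ≡ v

  valid? : Decidable₁ Valid
  valid? f = all? λ u → all? λ v →
    (part u ≟ part v) →-dec (lookup f u ≟ lookup f v) →-dec (u ≟ v)

  Holds : Placement → Assignment → Set
  Holds (u , i) f = lookup f u ≡ i

  holds? : Decidable Holds
  holds? (u , i) f = lookup f u ≟ i

  Occurs : Event → Assignment → Set
  Occurs (o , p , q) f = Holds o f × Holds p f × Holds q f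

  occurs? : Decidable Occurs
  occurs? (o , p , q) f = holds? o f ×-dec holds? p f ×-dec holds? q f

  -- Sharing a vertex of the graph, or a point of the host graph. Equal placements conflict as well,
  -- although they are compatible.
  Conflict : Placement → Placement → Set
  Conflict (u , i) (v , j) = u ≡ v ⊎ (part u ≡ part v × i ≡ j)

  conflict? : Decidable Conflict
  conflict? (u , i) (v , j) = (u ≟ v) ⊎-dec ((part u ≟ part v) ×-dec (i ≟ j))

  places : Event → List Placement
  places (o , p , q) = o ∷ p ∷ q ∷ []

  Neighbour : Event → Event → Set
  Neighbour A B = Any (λ a → Any (Conflict a) (places B)) (places A)

  neighbour? : Decidable Neighbour
  neighbour? A B = Any.any? (λ a → Any.any? (conflict? a) (places B)) (places A)

  open LocalLemma Ω valid? occurs? neighbour? public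

  -- The exchange acts on each coordinate separately, by a rule that does not depend on the
  -- assignment; hence `∑-allVecs-injection` applies to `swapIn`.
  move : Fin m → Fin n → Fin n → Fin k → Fin n → Fin n
  move c i j u x = if does (part u ≟ c) then transpose i j x else x

  swapIn : Fin m → Fin n → Fin n → Assignment → Assignment
  swapIn c i j f = Vec.tabulate (λ u → move c i j u (lookup f u))

  move-injective : ∀ c i j u {x y} → move c i j u x ≡ move c i j u y → x ≡ y
  move-injective c i j u eq with does (part u ≟ c)
  ... | true  = transpose-injective i j eq
  ... | false = eq

  move-fixed : ∀ {c i j} u {x} → (part u ≡ c → x ≢ i × x ≢ j) → move c i j u x ≡ x
  move-fixed {c} u h with part u ≟ c
  ... | yes u∈c = transpose-fixed (proj₁ (h u∈c)) (proj₂ (h u∈c))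
  ... | no _    = refl

  move-left : ∀ i j u → move (part u) i j u i ≡ j
  move-left i j u with part u ≟ part u
  ... | yes _  = transpose-left i j
  ... | no u∉c = contradiction refl u∉c

  lookup-swapIn : ∀ c i j f u → lookup (swapIn c i j f) u ≡ move c i j u (lookup f u)
  lookup-swapIn c i j f u = lookup∘tabulate _ u

  holds-swapIn : ∀ c i j f ((u , x) : Placement) → (part u ≡ c → x ≢ i × x ≢ j) →
                 Holds (u , x) f → Holds (u , x) (swapIn c i j f)
  holds-swapIn c i j f (u , x) h refl = trans (lookup-swapIn c i j f u) (move-fixed u h)

  -- Vertices of one part are moved by the same permutation, so a collision after the exchange comes
  -- from one before it.
  valid-swapIn : ∀ c i j f → Valid f → Valid (swapIn c i j f)
  valid-swapIn c i j f valid u v u~v eq = valid u v u~v (move-injective c i j u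
    (begin
      move c i j u (lookup f u) ≡⟨ lookup-swapIn c i j f u ⟨
      lookup (swapIn c i j f) u ≡⟨ eq ⟩
      lookup (swapIn c i j f) v ≡⟨ lookup-swapIn c i j f v ⟩
      move c i j v (lookup f v) ≡⟨ cong (λ d → if does (d ≟ c) then transpose i j (lookup f v) else lookup f v) u~v ⟨
      move c i j u (lookup f v) ∎))
    where open ≡-Reasoning

  -- Apart from the point `i` itself, a point of the class can gain a new occupant only from `i`,
  -- and by validity that occupant is `w`. A placement without conflict with `(w , i)` concerns
  -- neither `w` nor that point.
  holds-swapIn⁻ : ∀ w i j f b → Valid f → Holds (w , i) f → ¬ Conflict (w , i) b →
                  Holds b (swapIn (part w) i j f) → Holds b f
  holds-swapIn⁻ w i j f (u , x) valid fw ¬con holds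
    with part u ≟ part w | trans (sym (lookup-swapIn (part w) i j f u)) holds
  ... | no _    | eq = eq
  ... | yes u∼w | eq with transpose-preimage (λ x≡i → ¬con (inj₂ (sym u∼w , sym x≡i))) eq
  ...   | inj₁ fu≡x = fu≡x
  ...   | inj₂ fu≡i = contradiction (inj₁ (sym (valid u w u∼w (trans fu≡i (sym fw))))) ¬con

  -- The exchange may destroy events but creates no occurrence of a stranger to `A`. This is where
  -- the one-sidedness of the lopsided condition matters.
  avoids-swapIn : ∀ A w i j f {S} → All (λ B → ¬ Neighbour A B) S → (w , i) ∈ places A →
                  Holds (w , i) f → Avoids S f → Avoids S (swapIn (part w) i j f)
  avoids-swapIn A w i j f strange a∈A fw (valid , av) =
    valid-swapIn (part w) i j f valid , All.zipWith (λ {B} → unaffected B) (strange , av)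
    where
    unaffected : ∀ B → ¬ Neighbour A B × ¬ Occurs B f → ¬ Occurs B (swapIn (part w) i j f)
    unaffected B@(o , p , q) (¬AB , ¬B) (ho , hp , hq) =
      ¬B (back o (here refl) ho , back p (there (here refl)) hp , back q (there (there (here refl))) hq)
      where
      back : ∀ b → b ∈ places B → Holds b (swapIn (part w) i j f) → Holds b f
      back b b∈B = holds-swapIn⁻ w i j f b valid fw (λ con → ¬AB (lose a∈A (lose b∈B con)))

  -- Double counting. For each `j`, exchanging `i` with `g j` sends the outcomes in `E` with `w` at
  -- `i` injectively to outcomes in `E` with `w` at `g j`; for distinct `j` these targets are
  -- disjoint. Thus, given `E`, the vertex `w` is at `i` with probability at most 1/`r`.
  resample : ∀ w i {r} (g : Fin r → Fin n) → (∀ {j j′} → g j ≡ g j′ → j ≡ j′) →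
    ∀ {E : Assignment → Set} (E? : Decidable₁ E) →
    (∀ f j → Holds (w , i) f → E f → E (swapIn (part w) i (g j) f)) →
    r * (∑[ f ← Ω ] 𝟙 (holds? (w , i) f ×-dec E? f)) ≤ (∑[ f ← Ω ] 𝟙 (E? f))
  resample w i {r} g g-inj E? closed = begin
    r * (∑[ f ← Ω ] 𝟙 (at i f))
      ≡⟨ cong (_* (∑[ f ← Ω ] 𝟙 (at i f))) (length-allFin r) ⟨
    length (allFin r) * (∑[ f ← Ω ] 𝟙 (at i f))
      ≡⟨ ∑-const (allFin r) _ ⟨
    (∑[ j ← allFin r ] ∑[ f ← Ω ] 𝟙 (at i f))
      ≤⟨ ∑-mono (allFin r) moved ⟩
    (∑[ j ← allFin r ] ∑[ f ← Ω ] 𝟙 (at (g j) f))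
      ≡⟨ ∑-swap (allFin r) Ω ⟩
    (∑[ f ← Ω ] ∑[ j ← allFin r ] 𝟙 (at (g j) f))
      ≤⟨ ∑-mono Ω once ⟩
    (∑[ f ← Ω ] 𝟙 (E? f)) ∎
    where
    open ≤-Reasoning
    at : ∀ x f → Dec _
    at x f = holds? (w , x) f ×-dec E? f

    moved : ∀ j → (∑[ f ← Ω ] 𝟙 (at i f)) ≤ (∑[ f ← Ω ] 𝟙 (at (g j) f))
    moved j = ≤-trans
      (∑-mono Ω λ f → 𝟙-mono (λ { (refl , e) →
          trans (lookup-swapIn (part w) i (g j) f w) (move-left i (g j) w) , closed f j refl e })
        (at i f) (at (g j) (swapIn (part w) i (g j) f)))
      (∑-allVecs-injection (move (part w) i (g j)) (move-injective (part w) i (g j)) (𝟙 ∘ at (g j)))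

    once : ∀ f → (∑[ j ← allFin r ] 𝟙 (at (g j) f)) ≤ 𝟙 (E? f)
    once f = begin
      (∑[ j ← allFin r ] 𝟙 (at (g j) f))
        ≡⟨ ∑-cong (allFin r) (λ j → 𝟙-× (holds? (w , g j) f) (E? f)) ⟩
      (∑[ j ← allFin r ] (𝟙 (holds? (w , g j) f) * 𝟙 (E? f)))
        ≡⟨ ∑-*ʳ (𝟙 (E? f)) (allFin r) ⟩
      (∑[ j ← allFin r ] 𝟙 (holds? (w , g j) f)) * 𝟙 (E? f)
        ≤⟨ *-monoˡ-≤ (𝟙 (E? f)) (∑-Unique-≤1 (λ j → holds? (w , g j) f) (allFin⁺ r)
             (λ e e′ → g-inj (trans (sym e) e′))) ⟩
      1 * 𝟙 (E? f)
        ≡⟨ *-identityˡ _ ⟩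
      𝟙 (E? f) ∎

  -- Three resamplings, each preserving the conditions still imposed: `n` positions for the centre,
  -- `n` for the first end, and `n₀` for the second end, which may share its class with the first.
  independent : ∀ {o p q} → part (proj₁ o) ≢ part (proj₁ p) → part (proj₁ o) ≢ part (proj₁ q) →
    proj₁ p ≢ proj₁ q → ∀ S → All (λ B → ¬ Neighbour (o , p , q) B) S →
    n * (n * n₀) * #hitting (o , p , q) S ≤ #avoiding S
  independent {o@(v , y)} {p@(u , x)} {q@(w , z)} v≁u v≁w u≢w S strange = begin
    n * (n * n₀) * #hitting (o , p , q) S
      ≤⟨ *-monoʳ-≤ (n * (n * n₀)) (∑-mono Ω (λ f → 𝟙-mono
           (λ ((ho , hp , hq) , av) → hq , hp , ho , av)
           (occurs? (o , p , q) f ×-dec avoids? S f) (holds? q f ×-dec E₂? f))) ⟩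
    n * (n * n₀) * (∑[ f ← Ω ] 𝟙 (holds? q f ×-dec E₂? f))
      ≡⟨ trans (*-assoc n (n * n₀) _) (cong (n *_) (*-assoc n n₀ _)) ⟩
    n * (n * (n₀ * (∑[ f ← Ω ] 𝟙 (holds? q f ×-dec E₂? f))))
      -- `punchIn x` lists the `n₀` positions other than `x`, so the first end is not displaced when
      -- both ends lie in one class; `x ≢ z` then follows from validity.
      ≤⟨ *-monoʳ-≤ n (*-monoʳ-≤ n (resample w z (punchIn x) (punchIn-injective x _ _) E₂?
           (λ f j hq (hp , ho , av) →
               holds-swapIn (part w) z (punchIn x j) f p (λ u∼w →
                   (λ x≡z → u≢w (proj₁ av u w u∼w (trans hp (trans x≡z (sym hq)))))
                 , (λ x≡j → punchInᵢ≢i x j (sym x≡j))) hp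
             , holds-swapIn (part w) z (punchIn x j) f o (λ v∼w → contradiction v∼w v≁w) ho
             , avoids-swapIn C₀ w z (punchIn x j) f strange (there (there (here refl))) hq av))) ⟩
    n * (n * (∑[ f ← Ω ] 𝟙 (E₂? f)))
      ≤⟨ *-monoʳ-≤ n (resample u x id id E₁?
           (λ f j hp (ho , av) → holds-swapIn (part u) x j f o (λ v∼u → contradiction v∼u v≁u) ho
             , avoids-swapIn C₀ u x j f strange (there (here refl)) hp av)) ⟩
    n * (∑[ f ← Ω ] 𝟙 (E₁? f))
      ≤⟨ resample v y id id (avoids? S) (λ f j → avoids-swapIn C₀ v y j f strange (here refl)) ⟩
    #avoiding S ∎
    where
    open ≤-Reasoning
    C₀ : Event
    C₀ = o , p , q
    E₁? : Decidable₁ (λ f → Holds o f × Avoids S f)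
    E₁? f = holds? o f ×-dec avoids? S f
    E₂? : Decidable₁ (λ f → Holds p f × Holds o f × Avoids S f)
    E₂? f = holds? p f ×-dec E₁? f

-- Counting monochromatic cherries that conflict with a given event.

module Counting {m n₀ k : ℕ} (part : Fin k → Fin m) (G : Graph (Fin k)) (c : Coloring (K m (suc n₀)))
  (Δ b : ℕ)
  (part-proper : ∀ {u v} → Graph._~_ G u v → part u ≢ part v)
  (part-size : ∀ i → (∑[ u ← allFin k ] 𝟙 (i ≟ part u)) ≤ suc n₀)
  (degree-≤ : ∀ v → degree G v ≤ Δ)
  (colourDegree-≤ : ∀ a x → colourDegree c a x ≤ b) where

  open Graph G
  open Placements {m} {n₀} {k} part
  open Coloring c using (colour)
  open Graph (K m n) using () renaming (_~_ to _≁_; _~?_ to _≁?_)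

  point : Placement → Fin (m * n)
  point (u , i) = combine (part u) i

  -- Phrased through `EdgeOfColour`, so that for fixed `x` and `y` the points `z` are counted by
  -- `colourDegree`.
  SameColour : (x y z : Fin (m * n)) → Set
  SameColour x y z = Σ (x ≁ y) λ e → EdgeOfColour c (colour x y e) x z

  sameColour? : ∀ x y z → Dec (SameColour x y z)
  sameColour? x y z with x ≁? y
  ... | no ¬e = no (¬e ∘ proj₁)
  ... | yes e with edgeOfColour? c (colour x y e) x z
  ...   | yes f = yes (e , f)
  ...   | no ¬f = no (¬f ∘ proj₂)

  -- Symmetric in the two ends, unlike `Bad`: the counts are made for this relation and halved at
  -- the end.
  Monochromatic : Event → Set
  Monochromatic (o@(v , _) , p@(u , _) , q@(w , _)) =
    v ~ u × v ~ w × SameColour (point o) (point p) (point q)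

  monochromatic? : Decidable₁ Monochromatic
  monochromatic? (o@(v , _) , p@(u , _) , q@(w , _)) =
    (v ~? u) ×-dec (v ~? w) ×-dec sameColour? (point o) (point p) (point q)

  -- Ordering the two ends lets every cherry of G be counted only once.
  Bad : Event → Set
  Bad E@(o , p , q) = proj₁ p Fin.< proj₁ q × Monochromatic E

  bad? : Decidable₁ Bad
  bad? E@(o , p , q) = (proj₁ p <? proj₁ q) ×-dec monochromatic? E

  placements : List Placement
  placements = cartesianProduct (allFin k) (allFin n)

  events : List Event
  events = cartesianProduct placements (cartesianProduct placements placements)

  badEvents : List Event
  badEvents = filter bad? events

  ∑-placements : ∀ f → ∑ placements f ≡ (∑[ u ← allFin k ] ∑[ i ← allFin n ] f (u , i))
  ∑-placements f = ∑-cartesianProductWith _,_ (allFin k) (allFin n)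

  ∑-events : ∀ f → ∑ events f ≡
    (∑[ o ← placements ] ∑[ p ← placements ] ∑[ q ← placements ] f (o , p , q))
  ∑-events f = trans (∑-cartesianProductWith _,_ placements (cartesianProduct placements placements))
    (∑-cong placements (λ o → ∑-cartesianProductWith _,_ placements placements))

  flip-ends : Event → Event
  flip-ends (o , p , q) = o , q , p

  ∑-flip-ends : ∀ f → ∑ events (f ∘ flip-ends) ≡ ∑ events f
  ∑-flip-ends f = trans (∑-events (f ∘ flip-ends))
    (trans (∑-cong placements (λ o → ∑-swap placements placements)) (sym (∑-events f)))

  monochromatic-flip : ∀ E → Monochromatic E → Monochromatic (flip-ends E)
  monochromatic-flip E (vu , vw , e , f , eq) = vw , vu , f , e , sym eq

  #sameColour : ∀ x y (i : Fin m) → (∑[ j ← allFin n ] 𝟙 (sameColour? x y (combine i j))) ≤ b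
  #sameColour x y i = by-cases (x ≁? y)
    where
    open ≤-Reasoning
    by-cases : Dec (x ≁ y) → (∑[ j ← allFin n ] 𝟙 (sameColour? x y (combine i j))) ≤ b
    by-cases (no ¬e) = begin
      (∑[ j ← allFin n ] 𝟙 (sameColour? x y (combine i j)))
        ≤⟨ ∑-mono (allFin n) (λ j → 𝟙-mono (¬e ∘ proj₁) (sameColour? x y (combine i j)) (no id)) ⟩
      (∑[ j ← allFin n ] 0)
        ≡⟨ trans (∑-const (allFin n) 0) (*-zeroʳ (length (allFin n))) ⟩
      0
        ≤⟨ z≤n ⟩
      b ∎
    by-cases (yes e) = begin
      (∑[ j ← allFin n ] 𝟙 (sameColour? x y (combine i j)))
        ≤⟨ ∑-mono (allFin n) (λ j → 𝟙-mono proj₂ (sameColour? x y (combine i j)) (coloured? (combine i j))) ⟩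
      (∑[ j ← allFin n ] 𝟙 (coloured? (combine i j)))
        ≤⟨ ∑-injection (combine {m} i) (combine-injectiveʳ {m} i _ i _) (𝟙 ∘ coloured?) ⟩
      (∑[ z ← allFin (m * n) ] 𝟙 (coloured? z))
        ≡⟨ length-filter≡∑ coloured? (allFin (m * n)) ⟨
      colourDegree c (colour x y e) x
        ≤⟨ colourDegree-≤ (colour x y e) x ⟩
      b ∎
      where
      coloured? : ∀ z → Dec (EdgeOfColour c (colour x y e) x z)
      coloured? = edgeOfColour? c (colour x y e) x

  #neighbourhood : ∀ v → (∑[ u ← allFin k ] 𝟙 (v ~? u)) ≤ Δ
  #neighbourhood v = ≤-trans (≤-reflexive (sym (length-filter≡∑ (v ~?_) (allFin k)))) (degree-≤ v)

  ∑-allFin-const : ∀ r x → (∑[ i ← allFin r ] x) ≡ r * x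
  ∑-allFin-const r x = trans (∑-const (allFin r) x) (cong (_* x) (length-allFin r))

  #adjacent : ∀ v → (∑[ p ← placements ] 𝟙 (v ~? proj₁ p)) ≤ n * Δ
  #adjacent v = begin
    (∑[ p ← placements ] 𝟙 (v ~? proj₁ p))                ≡⟨ ∑-placements _ ⟩
    (∑[ u ← allFin k ] ∑[ i ← allFin n ] 𝟙 (v ~? u))      ≡⟨ ∑-cong (allFin k) (λ u → ∑-allFin-const n _) ⟩
    (∑[ u ← allFin k ] (n * 𝟙 (v ~? u)))                  ≡⟨ ∑-*ˡ n (allFin k) ⟩
    n * (∑[ u ← allFin k ] 𝟙 (v ~? u))                    ≤⟨ *-monoʳ-≤ n (#neighbourhood v) ⟩
    n * Δ                                                 ∎
    where open ≤-Reasoning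

  -- The same vertex has `n` positions; the same point can be taken by at most `n` vertices, those
  -- of its part.
  #conflict : ∀ a → (∑[ p ← placements ] 𝟙 (conflict? a p)) ≤ 2 * n
  #conflict (v , j) = begin
    (∑[ p ← placements ] 𝟙 (conflict? (v , j) p))
      ≡⟨ ∑-placements (𝟙 ∘ conflict? (v , j)) ⟩
    (∑[ u ← allFin k ] ∑[ i ← allFin n ] 𝟙 (conflict? (v , j) (u , i)))
      ≤⟨ ∑-mono (allFin k) (λ u → ∑-mono (allFin n) (λ i → ≤-trans
           (𝟙-cover id (conflict? (v , j) (u , i)) (v ≟ u) ((part v ≟ part u) ×-dec (j ≟ i)))
           (≤-reflexive (cong (𝟙 (v ≟ u) +_) (𝟙-× (part v ≟ part u) (j ≟ i)))))) ⟩
    (∑[ u ← allFin k ] ∑[ i ← allFin n ] (𝟙 (v ≟ u) + 𝟙 (part v ≟ part u) * 𝟙 (j ≟ i)))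
      ≡⟨ ∑-cong (allFin k) (λ u → trans (∑-+ (allFin n) {λ _ → 𝟙 (v ≟ u)})
           (cong₂ _+_ (∑-allFin-const n _) (∑-*ˡ (𝟙 (part v ≟ part u)) (allFin n)))) ⟩
    (∑[ u ← allFin k ] (n * 𝟙 (v ≟ u) + 𝟙 (part v ≟ part u) * (∑[ i ← allFin n ] 𝟙 (j ≟ i))))
      ≡⟨ trans (∑-+ (allFin k) {λ u → n * 𝟙 (v ≟ u)}) (cong₂ _+_ (∑-*ˡ n (allFin k)) (∑-*ʳ (∑[ i ← allFin n ] 𝟙 (j ≟ i)) (allFin k))) ⟩
    n * (∑[ u ← allFin k ] 𝟙 (v ≟ u)) + (∑[ u ← allFin k ] 𝟙 (part v ≟ part u)) * (∑[ i ← allFin n ] 𝟙 (j ≟ i))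
      ≤⟨ +-mono-≤ (*-monoʳ-≤ n (one v)) (*-mono-≤ (part-size (part v)) (one j)) ⟩
    n * 1 + n * 1
      ≡⟨ lemma n ⟩
    2 * n ∎
    where
    open ≤-Reasoning
    one : ∀ {r} (x : Fin r) → (∑[ y ← allFin r ] 𝟙 (x ≟ y)) ≤ 1
    one x = ∑-Unique-≤1 (x ≟_) (allFin⁺ _) (λ e e′ → trans (sym e) e′)
    lemma : ∀ n → n * 1 + n * 1 ≡ 2 * n
    lemma = solve-∀

  -- The second end has at most `Δ` vertices, and for each at most `b` points, since the edge from
  -- `o` to `p` fixes the colour.
  #monochromatic₁ : ∀ o p →
    (∑[ q ← placements ] 𝟙 (monochromatic? (o , p , q))) ≤ 𝟙 (proj₁ o ~? proj₁ p) * (Δ * b)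
  #monochromatic₁ o@(v , _) p@(u , _) = begin
    (∑[ q ← placements ] 𝟙 (monochromatic? (o , p , q)))
      ≡⟨ ∑-cong placements (λ (w , j) → trans (𝟙-× (v ~? u) ((v ~? w) ×-dec same? (w , j)))
           (cong (𝟙 (v ~? u) *_) (𝟙-× (v ~? w) (same? (w , j))))) ⟩
    (∑[ q ← placements ] (𝟙 (v ~? u) * (𝟙 (v ~? proj₁ q) * 𝟙 (same? q))))
      ≡⟨ ∑-*ˡ (𝟙 (v ~? u)) placements ⟩
    𝟙 (v ~? u) * (∑[ q ← placements ] (𝟙 (v ~? proj₁ q) * 𝟙 (same? q)))
      ≡⟨ cong (𝟙 (v ~? u) *_) (trans (∑-placements _) (∑-cong (allFin k) (λ w → ∑-*ˡ (𝟙 (v ~? w)) (allFin n)))) ⟩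
    𝟙 (v ~? u) * (∑[ w ← allFin k ] (𝟙 (v ~? w) * (∑[ j ← allFin n ] 𝟙 (same? (w , j)))))
      ≤⟨ *-monoʳ-≤ (𝟙 (v ~? u)) (∑-mono (allFin k) (λ w → *-monoʳ-≤ (𝟙 (v ~? w))
           (#sameColour (point o) (point p) (part w)))) ⟩
    𝟙 (v ~? u) * (∑[ w ← allFin k ] (𝟙 (v ~? w) * b))
      ≡⟨ cong (𝟙 (v ~? u) *_) (∑-*ʳ b (allFin k)) ⟩
    𝟙 (v ~? u) * ((∑[ w ← allFin k ] 𝟙 (v ~? w)) * b)
      ≤⟨ *-monoʳ-≤ (𝟙 (v ~? u)) (*-monoˡ-≤ b (#neighbourhood v)) ⟩
    𝟙 (v ~? u) * (Δ * b) ∎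
    where
    open ≤-Reasoning
    same? : ∀ q → Dec (SameColour (point o) (point p) (point q))
    same? q = sameColour? (point o) (point p) (point q)

  #monochromatic₂ : ∀ o →
    (∑[ p ← placements ] ∑[ q ← placements ] 𝟙 (monochromatic? (o , p , q))) ≤ n * Δ * (Δ * b)
  #monochromatic₂ o = begin
    (∑[ p ← placements ] ∑[ q ← placements ] 𝟙 (monochromatic? (o , p , q)))
      ≤⟨ ∑-mono placements (#monochromatic₁ o) ⟩
    (∑[ p ← placements ] (𝟙 (proj₁ o ~? proj₁ p) * (Δ * b)))
      ≡⟨ ∑-*ʳ (Δ * b) placements ⟩
    (∑[ p ← placements ] 𝟙 (proj₁ o ~? proj₁ p)) * (Δ * b)
      ≤⟨ *-monoˡ-≤ (Δ * b) (#adjacent (proj₁ o)) ⟩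
    n * Δ * (Δ * b) ∎
    where open ≤-Reasoning

  -- At most `2 * n` placements conflict with a given one; each, put in a fixed role, extends to at
  -- most `n * Δ * (Δ * b)` monochromatic events.
  roleBound : ℕ
  roleBound = 2 * n * (n * Δ * (Δ * b))

  centre end₁ end₂ : Event → Placement
  centre (o , p , q) = o
  end₁   (o , p , q) = p
  end₂   (o , p , q) = q

  #conflict-centre : ∀ a → (∑[ E ← events ] (𝟙 (conflict? a (centre E)) * 𝟙 (monochromatic? E))) ≤ roleBound
  #conflict-centre a = begin
    (∑[ E ← events ] (𝟙 (conflict? a (centre E)) * 𝟙 (monochromatic? E)))
      ≡⟨ ∑-events _ ⟩
    (∑[ o ← placements ] ∑[ p ← placements ] ∑[ q ← placements ] (𝟙 (conflict? a o) * 𝟙 (monochromatic? (o , p , q))))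
      ≡⟨ ∑-cong placements (λ o → trans (∑-cong placements (λ p → ∑-*ˡ (𝟙 (conflict? a o)) placements))
           (∑-*ˡ (𝟙 (conflict? a o)) placements)) ⟩
    (∑[ o ← placements ] (𝟙 (conflict? a o) * (∑[ p ← placements ] ∑[ q ← placements ] 𝟙 (monochromatic? (o , p , q)))))
      ≤⟨ ∑-mono placements (λ o → *-monoʳ-≤ (𝟙 (conflict? a o)) (#monochromatic₂ o)) ⟩
    (∑[ o ← placements ] (𝟙 (conflict? a o) * (n * Δ * (Δ * b))))
      ≡⟨ ∑-*ʳ (n * Δ * (Δ * b)) placements ⟩
    (∑[ o ← placements ] 𝟙 (conflict? a o)) * (n * Δ * (Δ * b))
      ≤⟨ *-monoˡ-≤ (n * Δ * (Δ * b)) (#conflict a) ⟩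
    roleBound ∎
    where open ≤-Reasoning

  #conflict-end₁ : ∀ a → (∑[ E ← events ] (𝟙 (conflict? a (end₁ E)) * 𝟙 (monochromatic? E))) ≤ roleBound
  #conflict-end₁ a = begin
    (∑[ E ← events ] (𝟙 (conflict? a (end₁ E)) * 𝟙 (monochromatic? E)))
      ≡⟨ trans (∑-events _) (∑-swap placements placements) ⟩
    (∑[ p ← placements ] ∑[ o ← placements ] ∑[ q ← placements ] (𝟙 (conflict? a p) * 𝟙 (monochromatic? (o , p , q))))
      ≡⟨ ∑-cong placements (λ p → trans (∑-cong placements (λ o → ∑-*ˡ (𝟙 (conflict? a p)) placements))
           (∑-*ˡ (𝟙 (conflict? a p)) placements)) ⟩
    (∑[ p ← placements ] (𝟙 (conflict? a p) * (∑[ o ← placements ] ∑[ q ← placements ] 𝟙 (monochromatic? (o , p , q)))))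
      ≤⟨ ∑-mono placements (λ p → *-monoʳ-≤ (𝟙 (conflict? a p)) (centred p)) ⟩
    (∑[ p ← placements ] (𝟙 (conflict? a p) * (n * Δ * (Δ * b))))
      ≡⟨ ∑-*ʳ (n * Δ * (Δ * b)) placements ⟩
    (∑[ p ← placements ] 𝟙 (conflict? a p)) * (n * Δ * (Δ * b))
      ≤⟨ *-monoˡ-≤ (n * Δ * (Δ * b)) (#conflict a) ⟩
    roleBound ∎
    where
    open ≤-Reasoning
    centred : ∀ p → (∑[ o ← placements ] ∑[ q ← placements ] 𝟙 (monochromatic? (o , p , q))) ≤ n * Δ * (Δ * b)
    centred p = begin
      (∑[ o ← placements ] ∑[ q ← placements ] 𝟙 (monochromatic? (o , p , q)))
        -- Symmetry of adjacency turns the count of centres into a count of neighbours of the first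
        -- end.
        ≤⟨ ∑-mono placements (λ o → ≤-trans (#monochromatic₁ o p)
             (*-monoˡ-≤ (Δ * b) (𝟙-mono ~-sym (proj₁ o ~? proj₁ p) (proj₁ p ~? proj₁ o)))) ⟩
      (∑[ o ← placements ] (𝟙 (proj₁ p ~? proj₁ o) * (Δ * b)))
        ≡⟨ ∑-*ʳ (Δ * b) placements ⟩
      (∑[ o ← placements ] 𝟙 (proj₁ p ~? proj₁ o)) * (Δ * b)
        ≤⟨ *-monoˡ-≤ (Δ * b) (#adjacent (proj₁ p)) ⟩
      n * Δ * (Δ * b) ∎

  #conflict-end₂ : ∀ a → (∑[ E ← events ] (𝟙 (conflict? a (end₂ E)) * 𝟙 (monochromatic? E))) ≤ roleBound
  #conflict-end₂ a = begin
    (∑[ E ← events ] (𝟙 (conflict? a (end₂ E)) * 𝟙 (monochromatic? E)))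
      ≡⟨ ∑-flip-ends (λ E → 𝟙 (conflict? a (end₂ E)) * 𝟙 (monochromatic? E)) ⟨
    (∑[ E ← events ] (𝟙 (conflict? a (end₁ E)) * 𝟙 (monochromatic? (flip-ends E))))
      ≤⟨ ∑-mono events (λ E → *-monoʳ-≤ (𝟙 (conflict? a (end₁ E)))
           (𝟙-mono (monochromatic-flip (flip-ends E)) (monochromatic? (flip-ends E)) (monochromatic? E))) ⟩
    (∑[ E ← events ] (𝟙 (conflict? a (end₁ E)) * 𝟙 (monochromatic? E)))
      ≤⟨ #conflict-end₁ a ⟩
    roleBound ∎
    where open ≤-Reasoning

  #conflictsOf : Placement → Event → ℕ
  #conflictsOf a E = ∑[ e ← places E ] 𝟙 (conflict? a e)

  #conflicts : Event → Event → ℕ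
  #conflicts A E = ∑[ a ← places A ] #conflictsOf a E

  -- Three places of `A` against three roles in `E` give the factor 9.
  ∑-#conflicts : ∀ A → (∑[ E ← events ] (𝟙 (monochromatic? E) * #conflicts A E)) ≤ 9 * roleBound
  ∑-#conflicts A = begin
    (∑[ E ← events ] (𝟙 (monochromatic? E) * #conflicts A E))
      ≡⟨ ∑-cong events (λ E → sym (∑-*ˡ (𝟙 (monochromatic? E)) (places A) {λ a → #conflictsOf a E})) ⟩
    (∑[ E ← events ] ∑[ a ← places A ] (𝟙 (monochromatic? E) * #conflictsOf a E))
      ≡⟨ ∑-swap events (places A) {λ E a → 𝟙 (monochromatic? E) * #conflictsOf a E} ⟩
    (∑[ a ← places A ] ∑[ E ← events ] (𝟙 (monochromatic? E) * #conflictsOf a E))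
      ≤⟨ ∑-mono (places A) {g = λ _ → roleBound + (roleBound + roleBound)} row ⟩
    (∑[ a ← places A ] (roleBound + (roleBound + roleBound)))
      ≡⟨ lemma roleBound ⟩
    9 * roleBound ∎
    where
    open ≤-Reasoning
    lemma : ∀ t → t + (t + t) + (t + (t + t) + (t + (t + t) + 0)) ≡ 9 * t
    lemma = solve-∀
    expand : ∀ x a b c → x * (a + (b + (c + 0))) ≡ a * x + (b * x + c * x)
    expand = solve-∀
    row : ∀ a → (∑[ E ← events ] (𝟙 (monochromatic? E) * #conflictsOf a E)) ≤ roleBound + (roleBound + roleBound)
    row a = begin
      (∑[ E ← events ] (𝟙 (monochromatic? E) * #conflictsOf a E))
        ≡⟨ ∑-cong events (λ E → expand (𝟙 (monochromatic? E))
             (𝟙 (conflict? a (centre E))) (𝟙 (conflict? a (end₁ E))) (𝟙 (conflict? a (end₂ E)))) ⟩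
      (∑[ E ← events ] (x centre E + (x end₁ E + x end₂ E)))
        ≡⟨ trans (∑-+ events) (cong (∑ events (x centre) +_) (∑-+ events)) ⟩
      ∑ events (x centre) + (∑ events (x end₁) + ∑ events (x end₂))
        ≤⟨ +-mono-≤ (#conflict-centre a) (+-mono-≤ (#conflict-end₁ a) (#conflict-end₂ a)) ⟩
      roleBound + (roleBound + roleBound) ∎
      where
      x : (Event → Placement) → Event → ℕ
      x role E = 𝟙 (conflict? a (role E)) * 𝟙 (monochromatic? E)

  #badNeighbours : Event → ℕ
  #badNeighbours A = ∑[ E ← badEvents ] 𝟙 (neighbour? A E)

  -- A monochromatic event and its flip both enter `∑-#conflicts`, but at most one of them has its
  -- ends in increasing order. This saves a factor 2.
  2*#badNeighbours : ∀ A → #badNeighbours A + #badNeighbours A ≤ 9 * roleBound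
  2*#badNeighbours A = begin
    #badNeighbours A + #badNeighbours A
      ≡⟨ cong₂ _+_ (∑-filter bad? events) (trans (∑-filter bad? events) (sym (∑-flip-ends g))) ⟩
    ∑ events g + ∑ events (g ∘ flip-ends)
      ≡⟨ ∑-+ events ⟨
    (∑[ E ← events ] (g E + g (flip-ends E)))
      ≤⟨ ∑-mono events both ⟩
    ∑ events H
      ≤⟨ ∑-#conflicts A ⟩
    9 * roleBound ∎
    where
    open ≤-Reasoning
    g H : Event → ℕ
    g E = 𝟙 (bad? E) * 𝟙 (neighbour? A E)
    H E = 𝟙 (monochromatic? E) * #conflicts A E

    #conflicts-flip : ∀ E → #conflicts A (flip-ends E) ≡ #conflicts A E
    #conflicts-flip E = ∑-cong (places A) {λ a → #conflictsOf a (flip-ends E)} {λ a → #conflictsOf a E} (λ a → lemma (𝟙 (conflict? a (centre E))) (𝟙 (conflict? a (end₂ E))) (𝟙 (conflict? a (end₁ E))))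
      where
      lemma : ∀ x y z → x + (y + (z + 0)) ≡ x + (z + (y + 0))
      lemma = solve-∀

    H-flip : ∀ E → H (flip-ends E) ≤ H E
    H-flip E = *-mono-≤
      (𝟙-mono (monochromatic-flip (flip-ends E)) (monochromatic? (flip-ends E)) (monochromatic? E))
      (≤-reflexive (#conflicts-flip E))

    neighbour-≤ : ∀ E → 𝟙 (neighbour? A E) ≤ #conflicts A E
    neighbour-≤ E = ≤-trans (𝟙-any≤∑ (λ a → Any.any? (conflict? a) (places E)) (places A))
      (∑-mono (places A) {g = λ a → #conflictsOf a E} (λ a → 𝟙-any≤∑ (conflict? a) (places E)))

    g-≤ : ∀ E → g E ≤ 𝟙 (proj₁ (end₁ E) <? proj₁ (end₂ E)) * H E
    g-≤ E = begin
      𝟙 (bad? E) * 𝟙 (neighbour? A E)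
        ≡⟨ cong (_* 𝟙 (neighbour? A E)) (𝟙-× (proj₁ (end₁ E) <? proj₁ (end₂ E)) (monochromatic? E)) ⟩
      𝟙 (proj₁ (end₁ E) <? proj₁ (end₂ E)) * 𝟙 (monochromatic? E) * 𝟙 (neighbour? A E)
        ≡⟨ *-assoc (𝟙 (proj₁ (end₁ E) <? proj₁ (end₂ E))) _ _ ⟩
      𝟙 (proj₁ (end₁ E) <? proj₁ (end₂ E)) * (𝟙 (monochromatic? E) * 𝟙 (neighbour? A E))
        ≤⟨ *-monoʳ-≤ (𝟙 (proj₁ (end₁ E) <? proj₁ (end₂ E))) (*-monoʳ-≤ (𝟙 (monochromatic? E)) (neighbour-≤ E)) ⟩
      𝟙 (proj₁ (end₁ E) <? proj₁ (end₂ E)) * H E ∎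

    both : ∀ E → g E + g (flip-ends E) ≤ H E
    both E@(_ , (u , _) , (w , _)) = begin
      g E + g (flip-ends E)
        ≤⟨ +-mono-≤ (g-≤ E) (g-≤ (flip-ends E)) ⟩
      𝟙 (u <? w) * H E + 𝟙 (w <? u) * H (flip-ends E)
        ≤⟨ +-monoʳ-≤ (𝟙 (u <? w) * H E) (*-monoʳ-≤ (𝟙 (w <? u)) (H-flip E)) ⟩
      𝟙 (u <? w) * H E + 𝟙 (w <? u) * H E
        ≡⟨ *-distribʳ-+ (H E) (𝟙 (u <? w)) (𝟙 (w <? u)) ⟨
      (𝟙 (u <? w) + 𝟙 (w <? u)) * H E
        ≤⟨ *-monoˡ-≤ (H E) (𝟙-exclusive Fin.<-asym (u <? w) (w <? u)) ⟩
      1 * H E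
        ≡⟨ *-identityˡ (H E) ⟩
      H E ∎

  -- The local lemma with `D` equal to `n * (n * n₀)`. Four times the number of bad neighbours is at
  -- most `18 * roleBound`, that is 36n²Δ²b, so the second hypothesis is the sparsity condition with
  -- n² cancelled.
  avoiding-exists : 2 ≤ n₀ → 36 * (Δ * Δ * b) ≤ n₀ → ∃ Valid →
                    ∃ λ f → Valid f × All (λ E → ¬ Occurs E f) badEvents
  avoiding-exists 2≤n₀ bound (f₀ , valid₀) =
    let f , pos = ∑-positive Ω (𝟙 ∘ avoids? badEvents)
          (#avoiding-positive (n * (n * n₀)) D>2 indep badEvents nonempty (All.all-filter bad? events) sparse)
    in f , 𝟙-positive (avoids? badEvents f) pos
    where
    open ≤-Reasoning
    nonempty : 1 ≤ #avoiding []
    nonempty = ≤-trans (𝟙-yes (avoids? [] f₀) (valid₀ , [])) (∈⇒≤∑ (𝟙 ∘ avoids? []) (∈-allVecs f₀))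
    D>2 : 2 < n * (n * n₀)
    D>2 = begin
      3            ≡⟨⟩
      3 * (1 * 1)  ≤⟨ *-mono-≤ (s≤s 2≤n₀) (*-mono-≤ {1} {n} (s≤s z≤n) (≤-trans (s≤s z≤n) 2≤n₀)) ⟩
      n * (n * n₀) ∎
    indep : ∀ {A} → Bad A → ∀ S → All (λ B → ¬ Neighbour A B) S → n * (n * n₀) * #hitting A S ≤ #avoiding S
    indep (u<w , v~u , v~w , _) = independent (part-proper v~u) (part-proper v~w) (Fin.<⇒≢ u<w)
    sparse : ∀ {A} → Bad A → 4 * #badNeighbours A ≤ n * (n * n₀)
    sparse {A} _ = begin
      4 * #badNeighbours A
        ≡⟨ split (#badNeighbours A) ⟩
      2 * (#badNeighbours A + #badNeighbours A)
        ≤⟨ *-monoʳ-≤ 2 (2*#badNeighbours A) ⟩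
      2 * (9 * roleBound)
        ≡⟨ regroup n Δ b ⟩
      n * (n * (36 * (Δ * Δ * b)))
        ≤⟨ *-monoʳ-≤ n (*-monoʳ-≤ n bound) ⟩
      n * (n * n₀) ∎
      where
      split : ∀ x → 4 * x ≡ 2 * (x + x)
      split = solve-∀
      regroup : ∀ n d b → 2 * (9 * (2 * n * (n * d * (d * b)))) ≡ n * (n * (36 * (d * d * b)))
      regroup = solve-∀

-- Existence of a valid assignment.

∑-𝟙-< : ∀ {A : Set} {P Q : A → Set} (P? : Decidable₁ P) (Q? : Decidable₁ Q) → (∀ {x} → P x → Q x) →
        ∀ {x xs} → x ∈ xs → Q x → ¬ P x → ∑ xs (𝟙 ∘ P?) < ∑ xs (𝟙 ∘ Q?)
∑-𝟙-< P? Q? P⇒Q {xs = x ∷ xs} (here refl) q ¬p with P? x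
... | yes p = contradiction p ¬p
... | no _  = +-mono-≤ (𝟙-yes (Q? x) q) (∑-mono xs (λ y → 𝟙-mono P⇒Q (P? y) (Q? y)))
∑-𝟙-< P? Q? P⇒Q {xs = y ∷ xs} (there x∈) q ¬p =
  +-mono-≤-< (𝟙-mono P⇒Q (P? y) (Q? y)) (∑-𝟙-< P? Q? P⇒Q x∈ q ¬p)

∑-allFin-suc : ∀ k f → ∑ (allFin (suc k)) f ≡ f zero + ∑ (allFin k) (f ∘ suc)
∑-allFin-suc k f = cong (f zero +_) (trans
  (cong (λ xs → ∑ xs f) (sym (map-tabulate id suc))) (∑-map suc (allFin k)))

∑-∈-≤-∣∣ : ∀ {k} (S : Subset k) → (∑[ u ← allFin k ] 𝟙 (u ∈? S)) ≤ ∣ S ∣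
∑-∈-≤-∣∣ []      = z≤n
∑-∈-≤-∣∣ {suc k} (s ∷ S) = ≤-trans (≤-reflexive (∑-allFin-suc k (λ u → 𝟙 (u ∈? (s ∷ S))))) (cases s)
  where
  tail : ∀ s → (∑[ u ← allFin k ] 𝟙 (suc u ∈? (s ∷ S))) ≤ ∣ S ∣
  tail s = ≤-trans (∑-mono (allFin k) (λ u → 𝟙-mono drop-there (suc u ∈? (s ∷ S)) (u ∈? S))) (∑-∈-≤-∣∣ S)
  cases : ∀ s → 𝟙 (zero ∈? (s ∷ S)) + (∑[ u ← allFin k ] 𝟙 (suc u ∈? (s ∷ S))) ≤ ∣ s ∷ S ∣
  cases inside  = s≤s (tail inside)
  cases outside = tail outside

module _ {m n₀ k} (part : Fin k → Fin m)
  (part-size : ∀ i → (∑[ u ← allFin k ] 𝟙 (i ≟ part u)) ≤ suc n₀) where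
  open Placements {m} {n₀} {k} part using (Valid)

  private
    earlier? : ∀ u v → Dec (part u ≡ part v × v Fin.< u)
    earlier? u v = (part u ≟ part v) ×-dec (v <? u)

    rank : Fin k → ℕ
    rank u = ∑[ v ← allFin k ] 𝟙 (earlier? u v)

    rank<n : ∀ u → rank u < suc n₀
    rank<n u = <-≤-trans
      (∑-𝟙-< (earlier? u) (λ v → part u ≟ part v) proj₁ (∈-allFin u) refl (λ (_ , u<u) → Fin.<-asym u<u u<u))
      (part-size (part u))

    rank-mono : ∀ {u v} → part u ≡ part v → u Fin.< v → rank u < rank v
    rank-mono {u} {v} u∼v u<v = ∑-𝟙-< (earlier? u) (earlier? v)
      (λ (u∼w , w<u) → trans (sym u∼v) u∼w , <-trans w<u u<v)
      (∈-allFin u) (sym u∼v , u<v) (λ (_ , u<u) → Fin.<-asym u<u u<u)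

  -- Every vertex is placed at its rank among the vertices of its part. The rank is below `suc n₀`
  -- because a vertex does not count itself.
  valid-exists : ∃ Valid
  valid-exists = f , valid
    where
    f : Vec (Fin (suc n₀)) k
    f = Vec.tabulate (λ u → fromℕ< (rank<n u))
    valid : Valid f
    valid u v u∼v fu≡fv with Fin.<-cmp u v | fromℕ<-injective (rank u) (rank v) (rank<n u) (rank<n v)
         (trans (sym (lookup∘tabulate _ u)) (trans fu≡fv (lookup∘tabulate _ v)))
    ... | tri< u<v _ _ | eq = contradiction eq (<⇒≢ (rank-mono u∼v u<v))
    ... | tri≈ _ u≡v _ | _  = u≡v
    ... | tri> _ _ v<u | eq = contradiction (sym eq) (<⇒≢ (rank-mono (sym u∼v) v<u))

-- From a properly coloured embedding to a subgraph.

module _ {k l} {H : Graph (Fin l)} {G : Graph (Fin k)} (c : Coloring H) where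
  open Graph G
  open Graph H using () renaming (_~_ to _~ᴴ_)
  open Coloring c

  properEmbedding⇒IsProper : (e : Fin k → Fin l) → (∀ {u v} → e u ≡ e v → u ≡ v) →
    (hom : ∀ {u v} → u ~ v → e u ~ᴴ e v) →
    (∀ {u v w} (uv : u ~ v) (uw : u ~ w) → v ≢ w →
      colour (e u) (e v) (hom uv) ≢ colour (e u) (e w) (hom uw)) →
    IsProper G c
  properEmbedding⇒IsProper e e-inj hom proper = copy , G≅copy , copy-proper
    where
    Image : Fin l → Set
    Image x = ∃ λ u → e u ≡ x

    image? : Decidable₁ Image
    image? x = any? (λ u → e u ≟ x)

    image : Subset l
    image = Vec.tabulate (does ∘ image?)

    ∈-image⁺ : ∀ u → e u ∈ˢ image
    ∈-image⁺ u = lookup⇒[]= (e u) image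
      (trans (lookup∘tabulate (does ∘ image?) (e u)) (dec-true (image? (e u)) (u , refl)))

    witness : ∀ {P : Set} (d : Dec P) → does d ≡ true → P
    witness (yes p) _ = p

    ∈-image⁻ : ∀ {x} → x ∈ˢ image → Image x
    ∈-image⁻ {x} x∈ = witness (image? x)
      (trans (sym (lookup∘tabulate (does ∘ image?) x)) ([]=⇒lookup x∈))

    copy : Subgraph H
    copy = record
      { vertices = image
      -- Only images of edges of `G` are taken: the induced subgraph on the image could have further
      -- edges.
      ; _~ₛ_     = λ x y → ∃₂ λ u v → e u ≡ x × e v ≡ y × u ~ v
      ; _~ₛ?_    = λ x y → any? λ u → any? λ v → (e u ≟ x) ×-dec (e v ≟ y) ×-dec (u ~? v)
      ; ~ₛ-sym   = λ (u , v , eu , ev , uv) → v , u , ev , eu , ~-sym uv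
      ; ~ₛ⇒~     = λ { {x} {y} (u , v , refl , refl , uv) → hom uv }
      ; ~ₛ⇒∈     = λ { {x} {y} (u , v , refl , refl , uv) → ∈-image⁺ u , ∈-image⁺ v }
      }

    G≅copy : G ≅ Subgraph.toGraph copy
    G≅copy = record
      { bijection = mk⤖ {to = λ u → e u , ∈-image⁺ u} (e-inj ∘ cong proj₁ , surjective)
      ; adjacency = λ u v → mk⇔ (λ uv → u , v , refl , refl , uv)
          (λ (u′ , v′ , eu , ev , uv) → subst₂ _~_ (e-inj eu) (e-inj ev) uv)
      }
      where
      surjective : ∀ y → ∃ λ u → ∀ {z} → z ≡ u → (e z , ∈-image⁺ z) ≡ y
      surjective (x , x∈) with ∈-image⁻ {x} x∈
      ... | u , refl = u , λ { refl → cong (e u ,_) ([]=-irrelevant _ _) }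

    copy-proper : ProperlyColored c copy
    -- The two edges come with separate preimages of their common endpoint, identified by
    -- injectivity.
    copy-proper _ _ _ (u , v , refl , refl , uv) (u′ , w , eu′ , refl , uw) v≢w with e-inj eu′
    copy-proper _ _ _ (u , v , refl , refl , uv) (_ , w , refl , refl , uw) v≢w | refl =
      proper uv uw (λ v≡w → v≢w (cong e v≡w))

-- Arithmetic of the colour bound.

-- Opened only here, since +_ makes sections such as (x +_) ambiguous.
open import Data.Integer.Base using (+_)

-- Fractions in ℚ are reduced to lowest terms, so the comparison is moved to unnormalised fractions,
-- where it is cross multiplication.
/-≤⇒*-≤ : ∀ a x d .{{_ : NonZero d}} → + a / 1 ℚ.≤ + x / d → a * d ≤ x
/-≤⇒*-≤ a x (suc d) le = ℤ.drop‿+≤+ (subst₂ ℤ._≤_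
  (sym (ℤ.pos-* a (suc d))) (ℤ.*-identityʳ (+ x)) (ℚᵘ.drop-*≤* unnormalised))
  where
  unnormalised : ℚᵘ.mkℚᵘ (+ a) 0 ℚᵘ.≤ ℚᵘ.mkℚᵘ (+ x) d
  unnormalised = ℚᵘ.≤-respʳ-≃ (ℚ.toℚᵘ-fromℚᵘ (ℚᵘ.mkℚᵘ (+ x) d))
    (ℚᵘ.≤-respˡ-≃ (ℚ.toℚᵘ-fromℚᵘ (ℚᵘ.mkℚᵘ (+ a) 0)) (ℚ.toℚᵘ-mono-≤ le))

*-≤⇒≤-/ : ∀ {a x d} .{{_ : NonZero d}} → a * d ≤ x → a ≤ x DivMod./ d
*-≤⇒≤-/ {a} {x} {d} ad≤x = ≤-trans (≤-reflexive (sym (DivMod.m*n/n≡m a d))) (DivMod./-monoˡ-≤ d ad≤x)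

-- With t = Δ²b ≥ 1, the surplus 12t of 48t over 36t pays for passing from n to n - 1.
36Δ²b-bound : ∀ {n₀ Δ b} → 1 ≤ Δ → 1 ≤ b → b * (48 * Δ ^ 2) ≤ suc n₀ → 36 * (Δ * Δ * b) ≤ n₀
36Δ²b-bound {n₀} {Δ} {b} 1≤Δ 1≤b bound = s≤s⁻¹ (begin
  1 + 36 * t        ≤⟨ +-monoˡ-≤ (36 * t) (≤-trans 1≤t (m≤n*m t 12)) ⟩
  12 * t + 36 * t   ≡⟨ lemma Δ b ⟩
  b * (48 * Δ ^ 2)  ≤⟨ bound ⟩
  suc n₀            ∎)
  where
  open ≤-Reasoning
  t : ℕ
  t = Δ * Δ * b
  1≤t : 1 ≤ t
  1≤t = *-mono-≤ (*-mono-≤ 1≤Δ 1≤Δ) 1≤b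
  lemma : ∀ Δ b → 12 * (Δ * Δ * b) + 36 * (Δ * Δ * b) ≡ b * (48 * (Δ * (Δ * 1)))
  lemma = solve-∀

degree≤maxDegree : ∀ {k} (G : Graph (Fin k)) v → degree G v ≤ maxDegree G
degree≤maxDegree {k} G v = All.lookup (xs≤max 0 _) (∈-map⁺ (degree G) (∈-allFin v))

quotient-combine : ∀ {m n} (i : Fin m) (j : Fin n) → quotient n (combine i j) ≡ i
quotient-combine i j = cong proj₁ (remQuot-combine i j)

-- Two classes already contain an edge, whose colour occurs at its endpoint. Hence the local bound
-- is at least 1, which forces n to be large compared with Δ².
K-edge-colour : ∀ {m n} → 2 ≤ m → 1 ≤ n → (c : Coloring (K m n)) → ∃₂ λ a x → 1 ≤ colourDegree c a x
K-edge-colour {m@(suc (suc _))} {n@(suc _)} (s≤s (s≤s _)) _ c = a , x , (begin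
  1                                        ≤⟨ 𝟙-yes (edgeOfColour? c a x y) (e , refl) ⟩
  𝟙 (edgeOfColour? c a x y)                ≤⟨ ∈⇒≤∑ (𝟙 ∘ edgeOfColour? c a x) (∈-allFin y) ⟩
  ∑ (allFin (m * n)) (𝟙 ∘ edgeOfColour? c a x) ≡⟨ length-filter≡∑ (edgeOfColour? c a x) (allFin (m * n)) ⟨
  colourDegree c a x                       ∎)
  where
  open ≤-Reasoning
  x y : Fin (m * n)
  x = combine {m} {n} zero zero
  y = combine {m} {n} (suc zero) zero
  e : Graph._~_ (K m n) x y
  e eq with trans (sym (quotient-combine {m} {n} zero zero)) (trans eq (quotient-combine {m} {n} (suc zero) zero))
  ... | ()
  a : ℕ
  a = Coloring.colour c x y e

-- Assembling the properly coloured copy.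

theorem1p5 : ∀ (m n : ℕ) → 2 ≤ m → 1 ≤ n →
    ∀ (k : ℕ) (G : Graph (Fin k)) (Δ : ℕ) .{{_ : NonZero Δ}} → maxDegree G ≡ Δ →
    ∀ (U : Fin m → Subset k) → IsPartition U →
    (∀ i → Independent G (U i)) → (∀ i → ∣ U i ∣ ≤ n) →
    ∀ (c : Coloring (K m n)) → LocallyBounded c (+ n / (48 * Δ ^ 2)) →
    IsProper G c
theorem1p5 m (suc n₀) 2≤m 1≤n k G Δ maxDegree≡Δ U partition independent size c bounded =
  properEmbedding⇒IsProper c e e-injective hom proper
  where
  open Graph G

  part : Fin k → Fin m
  part u = proj₁ (partition u)

  ∈-part : ∀ u → u ∈ˢ U (part u)
  ∈-part u = proj₁ (proj₂ (partition u))

  part-proper : ∀ {u v} → u ~ v → part u ≢ part v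
  part-proper {u} {v} uv u∼v =
    independent (part u) u v (∈-part u) (subst (λ i → v ∈ˢ U i) (sym u∼v) (∈-part v)) uv

  part-size : ∀ i → (∑[ u ← allFin k ] 𝟙 (i ≟ part u)) ≤ suc n₀
  part-size i = ≤-trans
    (∑-mono (allFin k) (λ u → 𝟙-mono (λ { refl → ∈-part u }) (i ≟ part u) (u ∈? U i)))
    (≤-trans (∑-∈-≤-∣∣ (U i)) (size i))

  degree-≤ : ∀ v → degree G v ≤ Δ
  degree-≤ v = subst (degree G v ≤_) maxDegree≡Δ (degree≤maxDegree G v)

  b : ℕ
  -- Colour degrees are integers, so the rational bound may be rounded down.
  b = suc n₀ DivMod./ (48 * Δ ^ 2)

  colourDegree-≤ : ∀ a x → colourDegree c a x ≤ b
  colourDegree-≤ a x = *-≤⇒≤-/ {d = 48 * Δ ^ 2}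
    (/-≤⇒*-≤ (colourDegree c a x) (suc n₀) (48 * Δ ^ 2) (bounded x a))

  1≤b : 1 ≤ b
  1≤b = let a , x , 1≤ = K-edge-colour 2≤m 1≤n c in ≤-trans 1≤ (colourDegree-≤ a x)

  1≤Δ : 1 ≤ Δ
  1≤Δ = >-nonZero⁻¹ Δ

  36Δ²b≤n₀ : 36 * (Δ * Δ * b) ≤ n₀
  36Δ²b≤n₀ = 36Δ²b-bound 1≤Δ 1≤b (DivMod.m/n*n≤m (suc n₀) (48 * Δ ^ 2))

  2≤n₀ : 2 ≤ n₀
  2≤n₀ = ≤-trans (*-mono-≤ {2} {36} (s≤s (s≤s z≤n)) (*-mono-≤ (*-mono-≤ 1≤Δ 1≤Δ) 1≤b)) 36Δ²b≤n₀

  open Placements {m} {n₀} {k} part using (Event; Valid; Occurs)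
  open Counting {m} {n₀} {k} part G c Δ b part-proper part-size degree-≤ colourDegree-≤

  good : ∃ λ f → Valid f × All (λ E → ¬ Occurs E f) badEvents
  good = avoiding-exists 2≤n₀ 36Δ²b≤n₀ (valid-exists part part-size)

  f : Vec (Fin (suc n₀)) k
  f = proj₁ good

  e : Fin k → Fin (m * suc n₀)
  e u = combine (part u) (lookup f u)

  e-injective : ∀ {u v} → e u ≡ e v → u ≡ v
  e-injective {u} {v} eq =
    let u∼v , fu≡fv = combine-injective (part u) (lookup f u) (part v) (lookup f v) eq
    in proj₁ (proj₂ good) u v u∼v fu≡fv

  hom : ∀ {u v} → u ~ v → Graph._~_ (K m (suc n₀)) (e u) (e v)
  hom {u} {v} uv eq = part-proper uv
    (trans (sym (quotient-combine (part u) (lookup f u))) (trans eq (quotient-combine (part v) (lookup f v))))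

  -- The event formed from the positions chosen by `f` occurs under `f` by definition, so it cannot
  -- belong to `badEvents`.
  unoccurring : ∀ u v w → v Fin.< w →
    ¬ Monochromatic ((u , lookup f u) , (v , lookup f v) , (w , lookup f w))
  unoccurring u v w v<w mono = All.lookup (proj₂ (proj₂ good)) E∈badEvents (refl , refl , refl)
    where
    E : Event
    E = (u , lookup f u) , (v , lookup f v) , (w , lookup f w)
    placed : ∀ p → p ∈ placements
    placed (u , i) = ∈-cartesianProduct⁺ (∈-allFin u) (∈-allFin i)
    E∈badEvents : E ∈ badEvents
    E∈badEvents = ∈-filter⁺ bad? {E} (∈-cartesianProduct⁺ (placed (u , lookup f u))
      (∈-cartesianProduct⁺ (placed (v , lookup f v)) (placed (w , lookup f w)))) (v<w , mono)

  proper : ∀ {u v w} (uv : u ~ v) (uw : u ~ w) → v ≢ w →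
    Coloring.colour c (e u) (e v) (hom uv) ≢ Coloring.colour c (e u) (e w) (hom uw)
  -- Bad events list the smaller end first, so the two edges are taken in the order of their ends.
  proper {u} {v} {w} uv uw v≢w same = by-cases (Fin.<-cmp v w)
    where
    by-cases : Tri (v Fin.< w) (v ≡ w) (w Fin.< v) → ⊥
    by-cases (tri< v<w _ _) = unoccurring u v w v<w (uv , uw , hom uv , hom uw , sym same)
    by-cases (tri≈ _ v≡w _) = v≢w v≡w
    by-cases (tri> _ _ w<v) = unoccurring u w v w<v (uw , uv , hom uw , hom uv , same)
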